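{- Let $\mathcal{Q}$ be a small quantaloid and let $S\dashv T:\mathbb{D}\to\mathbb{C}$ be an adjunction of $\mathcal{Q}$-functors between complete $\mathcal{Q}$-categories $\mathbb{C},\mathbb{D}$. Then a complete $\mathcal{Q}$-category $\mathbb{X}$ is equivalent to $\mathrm{Fix}(TS)$ if, and only if, there exist $\mathcal{Q}$-typed sets $A,B$, $\bigvee$-dense type-preserving maps $F:A\to\mathbb{X}_0$, $K:A\to\mathbb{C}_0$ and $\bigwedge$-dense type-preserving maps $G:B\to\mathbb{X}_0$, $H:B\to\mathbb{D}_0$ such that $\mathbb{D}(SKa,Hb)=\mathbb{X}(Fa,Gb)$ for all $a\in A$, $b\in B$.
   Context: A quantaloid $\mathcal{Q}$ is a category whose hom-sets are complete lattices and whose composition $\circ$ preserves joins in each variable; small means it has a set $\mathcal{Q}_0$ of objects; $1_q$ denotes identities. For $u:p\to q$, $w:p\to r$, the arrow $w\swarrow u:q\to r$ is determined by $v\circ u\leq w\iff v\leq w\swarrow u$ for all $v:q\to r$. A $\mathcal{Q}$-typed set is a set $A$ with a map $|\cdot|:A\to\mathcal{Q}_0$; maps preserving types are type-preserving. A $\mathcal{Q}$-category $\mathbb{A}$ is a $\mathcal{Q}$-typed set $\mathbb{A}_0$ with arrows $\mathbb{A}(x,y)\in\mathcal{Q}(|x|,|y|)$ such that $1_{|x|}\leq\mathbb{A}(x,x)$ and $\mathbb{A}(y,z)\circ\mathbb{A}(x,y)\leq\mathbb{A}(x,z)$. A $\mathcal{Q}$-subcategory is a subset of objects with the same hom-arrows.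 The underlying preorder: $x\leq y$ iff $|x|=|y|$ and $1_{|x|}\leq\mathbb{A}(x,y)$; $x\cong y$ means $x\leq y$ and $y\leq x$. A $\mathcal{Q}$-functor $F:\mathbb{A}\to\mathbb{B}$ is a type-preserving map $\mathbb{A}_0\to\mathbb{B}_0$ with $\mathbb{A}(x,x')\leq\mathbb{B}(Fx,Fx')$; $\mathcal{Q}$-functors are (pre)ordered pointwise, and $F\cong G$ means $F\leq G$ and $G\leq F$. $S\dashv T:\mathbb{D}\to\mathbb{C}$ means $\mathcal{Q}$-functors $S:\mathbb{C}\to\mathbb{D}$, $T:\mathbb{D}\to\mathbb{C}$ with $1_{\mathbb{C}}\leq TS$ and $ST\leq 1_{\mathbb{D}}$. $\mathrm{Fix}(TS)$ is the $\mathcal{Q}$-subcategory of $\mathbb{C}$ of objects $c$ with $TSc\cong c$. $\mathbb{A}$ and $\mathbb{B}$ are equivalent if there are $\mathcal{Q}$-functors $F:\mathbb{A}\to\mathbb{B}$, $G:\mathbb{B}\to\mathbb{A}$ with $GF\cong1_{\mathbb{A}}$, $FG\cong1_{\mathbb{B}}$. A presheaf of type $q$ on $\mathbb{A}$ is a family $\mu(x):|x|\to q$ $(x\in\mathbb{A}_0)$ with $\mu(x)\circ\mathbb{A}(x',x)\leq\mu(x')$. $\mathbb{A}$ is complete if every presheaf $\mu$ (of any type $q$) has a supremum, i.e. an object $s$ of type $q$ with $\mathbb{A}(s,y)=\bigwedge_{x\in\mathbb{A}_0}\mathbb{A}(x,y)\swarrow\mu(x)$ for all $y$. A type-preserving map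 $F:A\to\mathbb{B}_0$ is $\bigvee$-dense (resp. $\bigwedge$-dense) if for every $y\in\mathbb{B}_0$ there is a family $\{x_i\}_{i\in I}\subseteq A$ with $y\cong\bigvee_{i\in I}Fx_i$ (resp. $y\cong\bigwedge_{i\in I}Fx_i$) in the underlying preorder of $\mathbb{B}$; here objects of different types are incomparable, and joins and meets (including those of empty families) are taken among objects of the type of $y$. -}

module Defs where

open import Data.Product using (Σ; Σ-syntax; _×_; _,_; proj₁; proj₂)
open import Function using (flip)
open import Function.Bundles using (_⇔_; mk⇔)
open import Level using (Level; suc; _⊔_)
open import Relation.Binary.Bundles using (Poset)
open import Relation.Binary.Core using (Rel)

private
  variable
    a i r : Level

-- Joins and meets of a family in a preordered type.  In a preorder they are
-- determined only up to ≅, so "s ≅ ⋁ᵢ f i" means exactly "s is a join of f".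
IsJoin : {A : Set a} → Rel A r → {I : Set i} → (I → A) → A → Set (a ⊔ i ⊔ r)
IsJoin _≤_ f s = (∀ k → f k ≤ s) × (∀ t → (∀ k → f k ≤ t) → s ≤ t)

IsMeet : {A : Set a} → Rel A r → {I : Set i} → (I → A) → A → Set (a ⊔ i ⊔ r)
IsMeet _≤_ = IsJoin (flip _≤_)

-- Throughout, "set" means a type in one fixed universe Set ℓ: completeness
-- refers to all families indexed by types in Set ℓ.  Equality of elements of
-- a lattice is the equality _≈_ of the underlying poset.
record CompleteLattice (ℓ : Level) : Set (suc ℓ) where
  field
    poset : Poset ℓ ℓ ℓ
  open Poset poset public
  field
    ⋁      : {I : Set ℓ} → (I → Carrier) → Carrier
    ⋁-join : ∀ {I : Set ℓ} (f : I → Carrier) → IsJoin _≤_ f (⋁ f)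
    ⋀      : {I : Set ℓ} → (I → Carrier) → Carrier
    ⋀-meet : ∀ {I : Set ℓ} (f : I → Carrier) → IsMeet _≤_ f (⋀ f)

-- Small quantaloids: the objects form a type in Set ℓ.
record Quantaloid (ℓ : Level) : Set (suc ℓ) where
  infix  4 _⇒_
  infixr 9 _⊚_
  field
    Ob  : Set ℓ
    Hom : Ob → Ob → CompleteLattice ℓ

  _⇒_ : Ob → Ob → Set ℓ
  p ⇒ q = CompleteLattice.Carrier (Hom p q)

  open module HomLattice {p q : Ob} = CompleteLattice (Hom p q) public
    hiding (Carrier; poset)

  field
    𝟙        : ∀ q → q ⇒ q
    _⊚_      : ∀ {p q s} → q ⇒ s → p ⇒ q → p ⇒ s
    ⊚-cong   : ∀ {p q s} {v v′ : q ⇒ s} {u u′ : p ⇒ q} →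
               v ≈ v′ → u ≈ u′ → v ⊚ u ≈ v′ ⊚ u′
    identityˡ : ∀ {p q} (u : p ⇒ q) → 𝟙 q ⊚ u ≈ u
    identityʳ : ∀ {p q} (u : p ⇒ q) → u ⊚ 𝟙 p ≈ u
    assoc    : ∀ {p q s t} (w : s ⇒ t) (v : q ⇒ s) (u : p ⇒ q) →
               (w ⊚ v) ⊚ u ≈ w ⊚ (v ⊚ u)
    ⋁-⊚ : ∀ {p q s} {I : Set ℓ} (v : I → q ⇒ s) (u : p ⇒ q) →
          ⋁ v ⊚ u ≈ ⋁ (λ k → v k ⊚ u)
    ⊚-⋁ : ∀ {p q s} {I : Set ℓ} (v : q ⇒ s) (u : I → p ⇒ q) →
          v ⊚ ⋁ u ≈ ⋁ (λ k → v ⊚ u k)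

  infix 8 _↙_
  _↙_ : ∀ {p q s} → p ⇒ s → p ⇒ q → q ⇒ s
  _↙_ {q = q} {s} w u = ⋁ {I = Σ[ v ∈ q ⇒ s ] (v ⊚ u ≤ w)} proj₁

  ⊚-monoˡ : ∀ {p q s} {v v′ : q ⇒ s} (u : p ⇒ q) → v ≤ v′ → v ⊚ u ≤ v′ ⊚ u
  ⊚-monoˡ {q = q} {s} {v} {v′} u v≤v′ =
    trans (proj₁ (⋁-join (λ (k : I) → proj₁ k ⊚ u)) (v , v≤v′))
    (trans (reflexive (Eq.sym (⋁-⊚ proj₁ u)))
           (reflexive (⊚-cong ⋁≈v′ Eq.refl)))
    where
    I : Set ℓ
    I = Σ[ x ∈ q ⇒ s ] (x ≤ v′)
    ⋁≈v′ : ⋁ {I = I} proj₁ ≈ v′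
    ⋁≈v′ = antisym (proj₂ (⋁-join proj₁) v′ proj₂)
                   (proj₁ (⋁-join {I = I} proj₁) (v′ , refl))

  ↙-residual : ∀ {p q s} (w : p ⇒ s) (u : p ⇒ q) (v : q ⇒ s) →
               (v ⊚ u ≤ w) ⇔ (v ≤ w ↙ u)
  ↙-residual w u v = mk⇔
    (λ vu≤w → proj₁ (⋁-join proj₁) (v , vu≤w))
    (λ v≤w↙u → trans (⊚-monoˡ u v≤w↙u)
                (trans (reflexive (⋁-⊚ proj₁ u)) (proj₂ (⋁-join _) w proj₂)))

-- A set A with a type map |·| : A → Ob is represented by its fibres: A q is the
-- set of elements of type q, and the set of all elements is Σ Ob A.
-- Type-preserving maps are then families of maps between fibres.
infixr 0 _⟶_
_⟶_ : {O : Set a} → (O → Set i) → (O → Set r) → Set (a ⊔ i ⊔ r)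
A ⟶ B = ∀ {q} → A q → B q

module _ {ℓ : Level} (Q : Quantaloid ℓ) where
  open Quantaloid Q

  TypedSet : Set (suc ℓ)
  TypedSet = Ob → Set ℓ

  record QCategory : Set (suc ℓ) where
    field
      obj   : TypedSet
      hom   : ∀ {p q} → obj p → obj q → p ⇒ q
      hom-𝟙 : ∀ {q} (x : obj q) → 𝟙 q ≤ hom x x
      hom-⊚ : ∀ {p q s} (x : obj p) (y : obj q) (z : obj s) →
              hom y z ⊚ hom x y ≤ hom x z

    -- The underlying preorder; it relates only objects of the same type.
    infix 4 _⊑_ _≅_
    _⊑_ : ∀ {q} → obj q → obj q → Set ℓ
    _⊑_ {q} x y = 𝟙 q ≤ hom x y

    _≅_ : ∀ {q} → obj q → obj q → Set ℓ
    x ≅ y = x ⊑ y × y ⊑ x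

module _ {ℓ : Level} {Q : Quantaloid ℓ} where
  open Quantaloid Q
  open QCategory

  subcategory : (𝔸 : QCategory Q) → (∀ {q} → obj 𝔸 q → Set ℓ) → QCategory Q
  subcategory 𝔸 P = record
    { obj   = λ q → Σ[ x ∈ obj 𝔸 q ] P x
    ; hom   = λ x y → hom 𝔸 (proj₁ x) (proj₁ y)
    ; hom-𝟙 = λ x → hom-𝟙 𝔸 (proj₁ x)
    ; hom-⊚ = λ x y z → hom-⊚ 𝔸 (proj₁ x) (proj₁ y) (proj₁ z)
    }

  record QFunctor (𝔸 𝔹 : QCategory Q) : Set ℓ where
    field
      map     : obj 𝔸 ⟶ obj 𝔹
      map-hom : ∀ {p q} (x : obj 𝔸 p) (y : obj 𝔸 q) →
                hom 𝔸 x y ≤ hom 𝔹 (map x) (map y)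
  open QFunctor public

  idF : (𝔸 : QCategory Q) → QFunctor 𝔸 𝔸
  idF 𝔸 = record { map = λ x → x ; map-hom = λ _ _ → refl }

  infixr 9 _∘F_
  _∘F_ : ∀ {𝔸 𝔹 ℂ} → QFunctor 𝔹 ℂ → QFunctor 𝔸 𝔹 → QFunctor 𝔸 ℂ
  G ∘F F = record
    { map     = λ x → map G (map F x)
    ; map-hom = λ x y → trans (map-hom F x y) (map-hom G (map F x) (map F y))
    }

  infix 4 _≤F_ _≅F_
  _≤F_ : ∀ {𝔸 𝔹} → QFunctor 𝔸 𝔹 → QFunctor 𝔸 𝔹 → Set ℓ
  _≤F_ {𝔸} {𝔹} F G = ∀ {q} (x : obj 𝔸 q) → _⊑_ 𝔹 (map F x) (map G x)

  _≅F_ : ∀ {𝔸 𝔹} → QFunctor 𝔸 𝔹 → QFunctor 𝔸 𝔹 → Set ℓ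
  F ≅F G = (F ≤F G) × (G ≤F F)

  infix 4 _⊣_
  record _⊣_ {ℂ 𝔻 : QCategory Q} (S : QFunctor ℂ 𝔻) (T : QFunctor 𝔻 ℂ) : Set ℓ where
    field
      unit   : idF ℂ ≤F T ∘F S
      counit : S ∘F T ≤F idF 𝔻

  Fix : {ℂ : QCategory Q} → QFunctor ℂ ℂ → QCategory Q
  Fix {ℂ} E = subcategory ℂ (λ c → _≅_ ℂ (map E c) c)

  record Equivalent (𝔸 𝔹 : QCategory Q) : Set ℓ where
    field
      to      : QFunctor 𝔸 𝔹
      from    : QFunctor 𝔹 𝔸
      from∘to : from ∘F to ≅F idF 𝔸
      to∘from : to ∘F from ≅F idF 𝔹

  record Presheaf (𝔸 : QCategory Q) (q : Ob) : Set ℓ where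
    field
      at     : ∀ {p} → obj 𝔸 p → p ⇒ q
      action : ∀ {p p′} (x : obj 𝔸 p) (x′ : obj 𝔸 p′) →
               at x ⊚ hom 𝔸 x′ x ≤ at x′
  open Presheaf public

  IsSupremum : (𝔸 : QCategory Q) {q : Ob} → Presheaf 𝔸 q → obj 𝔸 q → Set ℓ
  IsSupremum 𝔸 μ s = ∀ {t} (y : obj 𝔸 t) →
    hom 𝔸 s y ≈ ⋀ {I = Σ Ob (obj 𝔸)} (λ (_ , x) → hom 𝔸 x y ↙ at μ x)

  Complete : QCategory Q → Set ℓ
  Complete 𝔸 = ∀ {q} (μ : Presheaf 𝔸 q) → Σ[ s ∈ obj 𝔸 q ] IsSupremum 𝔸 μ s

  ⋁-Dense : (A : TypedSet Q) (𝔹 : QCategory Q) → (A ⟶ obj 𝔹) → Set (suc ℓ)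
  ⋁-Dense A 𝔹 F = ∀ {q} (y : obj 𝔹 q) →
    Σ[ I ∈ Set ℓ ] Σ[ x ∈ (I → A q) ] IsJoin (_⊑_ 𝔹) (λ k → F (x k)) y

  ⋀-Dense : (A : TypedSet Q) (𝔹 : QCategory Q) → (A ⟶ obj 𝔹) → Set (suc ℓ)
  ⋀-Dense A 𝔹 F = ∀ {q} (y : obj 𝔹 q) →
    Σ[ I ∈ Set ℓ ] Σ[ x ∈ (I → A q) ] IsMeet (_⊑_ 𝔹) (λ k → F (x k)) y

{-# OPTIONS --safe #-}
module Submission where

-- Write E = TS.  Adjointness gives 𝔻(Sc, d) ≈ ℂ(c, Td), so E is an idempotent
-- closure operator on ℂ and every Td is fixed by E.
--
-- Only if.  Let 𝕏 be equivalent to Fix E through `from : Fix E → 𝕏`.  Take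
-- A = ℂ₀, K = id, F = from ∘ E and B = 𝔻₀, H = id, G = from ∘ T.  Every object
-- of 𝕏 is isomorphic to some Fc and to some Gd, so all density conditions hold
-- with one-element families, and
--   𝔻(Sc, d) ≈ ℂ(c, Td) ≈ ℂ(Ec, Td) ≈ 𝕏(Fc, Gd)
-- because `from` is fully faithful (`equivalence-fullyFaithful`).
--
-- If.  Completeness provides the Kan extensions φ = Lan_F K : 𝕏 → ℂ and
-- χ = Lan_K F : ℂ → 𝕏, that is, the weighted suprema
--   φ x = sup of K weighted by 𝕏(F-, x),   χ c = sup of F weighted by ℂ(K-, c).
-- By adjointness the hypothesis reads ℂ(Ka, THb) ≈ 𝕏(Fa, Gb); as F and K are
-- ⋁-dense, it extends (`Lan-hom`) to
--   ℂ(φx, THb) ≈ 𝕏(x, Gb)   and   𝕏(χc, Gb) ≈ ℂ(c, THb).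
-- Hence χEφx and x, respectively Sφχc and Sc, have the same hom-arrows into the
-- ⋀-dense family G, respectively H, and are therefore isomorphic
-- (`⋀-dense-separates`).  So Eφ and the restriction of χ to Fix E are mutually
-- inverse up to isomorphism.
--
-- The passage from ⋁-density, which concerns joins in the underlying preorder
-- only, to hom-arrows rests on `join-conical`: in a complete category a join x
-- of objects x k satisfies hom x y = ⋀ₖ hom (x k) y for all y of all types.

open import Defs
open import Level using (Level)
open import Data.Product using (Σ; Σ-syntax; _×_; _,_; proj₁; proj₂)
open import Data.Unit.Polymorphic using (⊤)
open import Function using (id)
open import Function.Bundles using (_⇔_; mk⇔; Equivalence)
import Relation.Binary.Reasoning.PartialOrder as PosetReasoning

private
  variable
    ℓ : Level

-- Quantaloids

module QuantaloidProperties (Q : Quantaloid ℓ) where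
  open Quantaloid Q

  module ≤-Reasoning {p q : Ob} = PosetReasoning (CompleteLattice.poset (Hom p q))

  ⊚-monoʳ : ∀ {p q s} (v : q ⇒ s) {u u′ : p ⇒ q} → u ≤ u′ → v ⊚ u ≤ v ⊚ u′
  ⊚-monoʳ {p} {q} v {u} {u′} u≤u′ = begin
    v ⊚ u                ≤⟨ proj₁ (⋁-join (λ (k : I) → v ⊚ proj₁ k)) (u , u≤u′) ⟩
    ⋁ (λ (k : I) → v ⊚ proj₁ k) ≈⟨ ⊚-⋁ v proj₁ ⟨
    v ⊚ ⋁ {I = I} proj₁  ≈⟨ ⊚-cong Eq.refl ⋁≈u′ ⟩
    v ⊚ u′               ∎
    where
    open ≤-Reasoning
    -- As binary joins are not primitive, u′ is written as the join of all
    -- arrows below it, one of which is u.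
    I : Set _
    I = Σ[ x ∈ p ⇒ q ] (x ≤ u′)
    ⋁≈u′ : ⋁ {I = I} proj₁ ≈ u′
    ⋁≈u′ = antisym (proj₂ (⋁-join proj₁) u′ proj₂)
                   (proj₁ (⋁-join {I = I} proj₁) (u′ , refl))

-- Hom-arrows and the underlying preorder

module QCategoryProperties {Q : Quantaloid ℓ} (𝔸 : QCategory Q) where
  open Quantaloid Q
  open QuantaloidProperties Q
  open QCategory 𝔸

  hom-antitoneˡ : ∀ {p q} {x x′ : obj p} (y : obj q) → x ⊑ x′ → hom x′ y ≤ hom x y
  hom-antitoneˡ {x = x} {x′} y x⊑x′ = begin
    hom x′ y             ≈⟨ identityʳ _ ⟨
    hom x′ y ⊚ 𝟙 _       ≤⟨ ⊚-monoʳ _ x⊑x′ ⟩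
    hom x′ y ⊚ hom x x′  ≤⟨ hom-⊚ x x′ y ⟩
    hom x y              ∎
    where open ≤-Reasoning

  hom-monotoneʳ : ∀ {p q} (x : obj p) {y y′ : obj q} → y ⊑ y′ → hom x y ≤ hom x y′
  hom-monotoneʳ x {y} {y′} y⊑y′ = begin
    hom x y              ≈⟨ identityˡ _ ⟨
    𝟙 _ ⊚ hom x y        ≤⟨ ⊚-monoˡ _ y⊑y′ ⟩
    hom y y′ ⊚ hom x y   ≤⟨ hom-⊚ x y y′ ⟩
    hom x y′             ∎
    where open ≤-Reasoning

  hom-congˡ : ∀ {p q} {x x′ : obj p} (y : obj q) → x ≅ x′ → hom x y ≈ hom x′ y
  hom-congˡ y (x⊑x′ , x′⊑x) = antisym (hom-antitoneˡ y x′⊑x) (hom-antitoneˡ y x⊑x′)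

  ⊑-trans : ∀ {q} {x y z : obj q} → x ⊑ y → y ⊑ z → x ⊑ z
  ⊑-trans {x = x} x⊑y y⊑z = trans x⊑y (hom-monotoneʳ x y⊑z)

  ≅-refl : ∀ {q} (x : obj q) → x ≅ x
  ≅-refl x = hom-𝟙 x , hom-𝟙 x

  ≅-trans : ∀ {q} {x y z : obj q} → x ≅ y → y ≅ z → x ≅ z
  ≅-trans (x⊑y , y⊑x) (y⊑z , z⊑y) = ⊑-trans x⊑y y⊑z , ⊑-trans z⊑y y⊑x

  singleton-join : ∀ {q} {x y : obj q} → x ≅ y → IsJoin _⊑_ (λ (_ : ⊤ {ℓ}) → x) y
  singleton-join (x⊑y , y⊑x) = (λ _ → x⊑y) , λ _ x⊑t → ⊑-trans y⊑x (x⊑t _)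

  singleton-meet : ∀ {q} {x y : obj q} → x ≅ y → IsMeet _⊑_ (λ (_ : ⊤ {ℓ}) → x) y
  singleton-meet (x⊑y , y⊑x) = (λ _ → y⊑x) , λ _ t⊑x → ⊑-trans (t⊑x _) x⊑y

  essSurjective⇒⋁-dense : (A : TypedSet Q) (F : A ⟶ obj) →
    (∀ {q} (y : obj q) → Σ[ a ∈ A q ] F a ≅ y) → ⋁-Dense A 𝔸 F
  essSurjective⇒⋁-dense A F surj y =
    ⊤ , (λ _ → proj₁ (surj y)) , singleton-join (proj₂ (surj y))

  essSurjective⇒⋀-dense : (A : TypedSet Q) (F : A ⟶ obj) →
    (∀ {q} (y : obj q) → Σ[ a ∈ A q ] F a ≅ y) → ⋀-Dense A 𝔸 F
  essSurjective⇒⋀-dense A F surj y =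
    ⊤ , (λ _ → proj₁ (surj y)) , singleton-meet (proj₂ (surj y))

  -- Objects with the same hom-arrows into a ⋀-dense family are isomorphic.
  ⋀-dense-separates : (B : TypedSet Q) (G : B ⟶ obj) → ⋀-Dense B 𝔸 G →
    ∀ {q} (x x′ : obj q) → (∀ {t} (b : B t) → hom x (G b) ≈ hom x′ (G b)) → x ≅ x′
  ⋀-dense-separates B G dense x x′ same =
    below x x′ (λ b → reflexive (Eq.sym (same b))) ,
    below x′ x (λ b → reflexive (same b))
    where
    below : ∀ {q} (y z : obj q) → (∀ {t} (b : B t) → hom z (G b) ≤ hom y (G b)) → y ⊑ z
    below y z le with dense z
    ... | _ , b , lower , greatest = greatest y λ k → trans (lower k) (le (b k))

-- Weighted suprema

module _ {Q : Quantaloid ℓ} (𝔸 : QCategory Q) where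
  open Quantaloid Q
  open QuantaloidProperties Q
  open QCategory 𝔸
  open QCategoryProperties 𝔸

  -- s is the supremum of the family x weighted by w, expressed by its universal
  -- property: hom s y is the largest v with v ⊚ w j ≤ hom (x j) y for all j.
  IsWeightedSup : ∀ {J : Set ℓ} {t : J → Ob} {q} →
    (∀ j → t j ⇒ q) → (∀ j → obj (t j)) → obj q → Set ℓ
  IsWeightedSup {q = q} w x s = ∀ {r} (y : obj r) (v : q ⇒ r) →
    (v ≤ hom s y) ⇔ (∀ j → v ⊚ w j ≤ hom (x j) y)

  -- The presheaf on 𝔸 generated by the weights w j at the objects x j.
  generatedPresheaf : ∀ {J : Set ℓ} {t : J → Ob} {q} →
    (∀ j → t j ⇒ q) → (∀ j → obj (t j)) → Presheaf 𝔸 q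
  generatedPresheaf w x = record
    { at     = λ z → ⋁ (λ j → w j ⊚ hom z (x j))
    ; action = λ z z′ → begin
        ⋁ (λ j → w j ⊚ hom z (x j)) ⊚ hom z′ z    ≈⟨ ⋁-⊚ _ _ ⟩
        ⋁ (λ j → (w j ⊚ hom z (x j)) ⊚ hom z′ z)  ≤⟨ proj₂ (⋁-join _) _ (λ j → begin
            (w j ⊚ hom z (x j)) ⊚ hom z′ z  ≈⟨ assoc _ _ _ ⟩
            w j ⊚ (hom z (x j) ⊚ hom z′ z)  ≤⟨ ⊚-monoʳ _ (hom-⊚ z′ z (x j)) ⟩
            w j ⊚ hom z′ (x j)              ≤⟨ proj₁ (⋁-join _) j ⟩
            ⋁ (λ j → w j ⊚ hom z′ (x j))    ∎) ⟩
        ⋁ (λ j → w j ⊚ hom z′ (x j))              ∎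
    }
    where open ≤-Reasoning

  weightedSup : Complete 𝔸 → ∀ {J : Set ℓ} {t : J → Ob} {q}
    (w : ∀ j → t j ⇒ q) (x : ∀ j → obj (t j)) → Σ[ s ∈ obj q ] IsWeightedSup w x s
  weightedSup complete {q = q} w x = s , λ y v → mk⇔ (restrict y v) (extend y v)
    where
    open ≤-Reasoning
    μ : Presheaf 𝔸 q
    μ = generatedPresheaf w x
    s : obj q
    s = proj₁ (complete μ)

    restrict : ∀ {r} (y : obj r) (v : q ⇒ r) → v ≤ hom s y →
      ∀ j → v ⊚ w j ≤ hom (x j) y
    restrict y v v≤ j = begin
      v ⊚ w j        ≤⟨ ⊚-monoʳ v wj≤μ ⟩
      v ⊚ at μ (x j) ≤⟨ Equivalence.from (↙-residual _ _ v) (begin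
        v                                             ≤⟨ v≤ ⟩
        hom s y                                       ≈⟨ proj₂ (complete μ) y ⟩
        ⋀ {I = Σ Ob obj} (λ (_ , z) → hom z y ↙ at μ z) ≤⟨ proj₁ (⋀-meet _) (_ , x j) ⟩
        hom (x j) y ↙ at μ (x j)                      ∎) ⟩
      hom (x j) y    ∎
      where
      wj≤μ : w j ≤ at μ (x j)
      wj≤μ = begin
        w j                     ≈⟨ identityʳ _ ⟨
        w j ⊚ 𝟙 _               ≤⟨ ⊚-monoʳ _ (hom-𝟙 (x j)) ⟩
        w j ⊚ hom (x j) (x j)   ≤⟨ proj₁ (⋁-join _) j ⟩
        at μ (x j)              ∎

    extend : ∀ {r} (y : obj r) (v : q ⇒ r) → (∀ j → v ⊚ w j ≤ hom (x j) y) →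
      v ≤ hom s y
    extend y v le = begin
      v                                             ≤⟨ proj₂ (⋀-meet _) v (λ (_ , z) →
                                                         Equivalence.to (↙-residual _ _ v) (bound z)) ⟩
      ⋀ {I = Σ Ob obj} (λ (_ , z) → hom z y ↙ at μ z) ≈⟨ proj₂ (complete μ) y ⟨
      hom s y                                       ∎
      where
      bound : ∀ {p} (z : obj p) → v ⊚ at μ z ≤ hom z y
      bound z = begin
        v ⊚ at μ z                           ≈⟨ ⊚-⋁ _ _ ⟩
        ⋁ (λ j → v ⊚ (w j ⊚ hom z (x j)))    ≤⟨ proj₂ (⋁-join _) _ (λ j → begin
            v ⊚ (w j ⊚ hom z (x j))    ≈⟨ assoc _ _ _ ⟨
            (v ⊚ w j) ⊚ hom z (x j)    ≤⟨ ⊚-monoˡ _ (le j) ⟩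
            hom (x j) y ⊚ hom z (x j)  ≤⟨ hom-⊚ z (x j) y ⟩
            hom z y                    ∎) ⟩
        hom z y                              ∎

  -- A join s in the underlying preorder agrees with the supremum weighted by
  -- identities, so it also controls the hom-arrows to objects of other types.
  join-conical : Complete 𝔸 → ∀ {q} {I : Set ℓ} (x : I → obj q) (s : obj q) →
    IsJoin _⊑_ x s → ∀ {r} (y : obj r) (v : q ⇒ r) →
    (∀ k → v ≤ hom (x k) y) → v ≤ hom s y
  join-conical complete {q} x s (_ , least) y v le = begin
    v         ≤⟨ Equivalence.from (isSup y v) (λ k → begin
                   v ⊚ 𝟙 q     ≈⟨ identityʳ v ⟩
                   v           ≤⟨ le k ⟩
                   hom (x k) y ∎) ⟩
    hom s′ y  ≤⟨ hom-antitoneˡ y (least s′ x⊑s′) ⟩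
    hom s y   ∎
    where
    open ≤-Reasoning
    s′ : obj q
    s′ = proj₁ (weightedSup complete (λ _ → 𝟙 q) x)
    isSup : IsWeightedSup (λ _ → 𝟙 q) x s′
    isSup = proj₂ (weightedSup complete (λ _ → 𝟙 q) x)
    x⊑s′ : ∀ k → x k ⊑ s′
    x⊑s′ k = begin
      𝟙 q           ≈⟨ identityʳ _ ⟨
      𝟙 q ⊚ 𝟙 q     ≤⟨ Equivalence.to (isSup s′ (𝟙 q)) (hom-𝟙 s′) k ⟩
      hom (x k) s′  ∎

  -- For a ⋁-dense F, hom x y is the largest v with v ⊚ hom (F a) x ≤ hom (F a) y
  -- for all a; this is the half of that fact that needs density.
  ⋁-dense-hom : Complete 𝔸 → (A : TypedSet Q) (F : A ⟶ obj) → ⋁-Dense A 𝔸 F →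
    ∀ {q r} (x : obj q) (y : obj r) (v : q ⇒ r) →
    (∀ {p} (a : A p) → v ⊚ hom (F a) x ≤ hom (F a) y) → v ≤ hom x y
  ⋁-dense-hom complete A F dense {q} x y v le with dense x
  ... | _ , a , isJoin = join-conical complete (λ k → F (a k)) x isJoin y v λ k → begin
    v                     ≈⟨ identityʳ v ⟨
    v ⊚ 𝟙 q               ≤⟨ ⊚-monoʳ v (proj₁ isJoin k) ⟩
    v ⊚ hom (F (a k)) x   ≤⟨ le (a k) ⟩
    hom (F (a k)) y       ∎
    where open ≤-Reasoning

-- Kan extensions along maps from typed sets

module KanExtension {Q : Quantaloid ℓ} {𝔸 𝔹 : QCategory Q} (complete : Complete 𝔹)
  {A : TypedSet Q} (F : A ⟶ QCategory.obj 𝔸) (K : A ⟶ QCategory.obj 𝔹) where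
  open Quantaloid Q
  open QuantaloidProperties Q
  open QCategory

  private
    sup : ∀ {q} (x : obj 𝔸 q) →
      Σ[ s ∈ obj 𝔹 q ] IsWeightedSup 𝔹 {J = Σ Ob A}
        (λ (_ , a) → hom 𝔸 (F a) x) (λ (_ , a) → K a) s
    sup x = weightedSup 𝔹 complete _ _

  Lan-universal : ∀ {q r} (x : obj 𝔸 q) (y : obj 𝔹 r) (v : q ⇒ r) →
    (v ≤ hom 𝔹 (proj₁ (sup x)) y) ⇔
    (∀ ((_ , a) : Σ Ob A) → v ⊚ hom 𝔸 (F a) x ≤ hom 𝔹 (K a) y)
  Lan-universal x = proj₂ (sup x)

  -- The unit of the Kan extension: hom 𝔸 (F a) x ≤ hom 𝔹 (K a) (Lan x).
  Lan-unit : ∀ {p q} (a : A p) (x : obj 𝔸 q) →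
    hom 𝔸 (F a) x ≤ hom 𝔹 (K a) (proj₁ (sup x))
  Lan-unit a x = begin
    hom 𝔸 (F a) x                ≈⟨ identityˡ _ ⟨
    𝟙 _ ⊚ hom 𝔸 (F a) x          ≤⟨ Equivalence.to (Lan-universal x _ _) (hom-𝟙 𝔹 _) (_ , a) ⟩
    hom 𝔹 (K a) (proj₁ (sup x))  ∎
    where open ≤-Reasoning

  -- The pointwise left Kan extension of K along F: it sends x to the supremum
  -- of K weighted by hom 𝔸 (F -) x.
  Lan : QFunctor 𝔸 𝔹
  Lan = record
    { map     = λ x → proj₁ (sup x)
    ; map-hom = λ x x′ → Equivalence.from (Lan-universal x _ _) λ (_ , a) →
        trans (hom-⊚ 𝔸 (F a) x x′) (Lan-unit a x′)
    }

  -- If y and z receive the same hom-arrows from F and K, respectively, then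
  -- they receive the same hom-arrows from x and Lan x.
  Lan-hom : Complete 𝔸 → ⋁-Dense A 𝔸 F →
    ∀ {r} (y : obj 𝔸 r) (z : obj 𝔹 r) →
    (∀ {p} (a : A p) → hom 𝔸 (F a) y ≈ hom 𝔹 (K a) z) →
    ∀ {q} (x : obj 𝔸 q) → hom 𝔹 (map Lan x) z ≈ hom 𝔸 x y
  Lan-hom complete𝔸 dense y z same x = antisym
    (⋁-dense-hom 𝔸 complete𝔸 A F dense x y _ λ a →
      trans (Equivalence.to (Lan-universal x z _) refl (_ , a))
            (reflexive (Eq.sym (same a))))
    (Equivalence.from (Lan-universal x z _) λ (_ , a) →
      trans (hom-⊚ 𝔸 (F a) x y) (reflexive (same a)))

-- Functors, equivalences and adjunctions

module _ {Q : Quantaloid ℓ} where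
  open Quantaloid Q
  open QuantaloidProperties Q
  open QCategory

  map-⊑ : {𝔸 𝔹 : QCategory Q} (F : QFunctor 𝔸 𝔹) → ∀ {q} {x y : obj 𝔸 q} →
    _⊑_ 𝔸 x y → _⊑_ 𝔹 (map F x) (map F y)
  map-⊑ F {x = x} {y} x⊑y = trans x⊑y (map-hom F x y)

  map-≅ : {𝔸 𝔹 : QCategory Q} (F : QFunctor 𝔸 𝔹) → ∀ {q} {x y : obj 𝔸 q} →
    _≅_ 𝔸 x y → _≅_ 𝔹 (map F x) (map F y)
  map-≅ F (x⊑y , y⊑x) = map-⊑ F x⊑y , map-⊑ F y⊑x

  equivalence-fullyFaithful : {𝔸 𝔹 : QCategory Q} (e : Equivalent 𝔸 𝔹) →
    let open Equivalent e in
    ∀ {p q} (x : obj 𝔹 p) (y : obj 𝔹 q) → hom 𝔹 x y ≈ hom 𝔸 (map from x) (map from y)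
  equivalence-fullyFaithful {𝔸} {𝔹} e x y = antisym (map-hom from x y) (begin
    hom 𝔸 (map from x) (map from y)                    ≤⟨ map-hom to _ _ ⟩
    hom 𝔹 (map to (map from x)) (map to (map from y))  ≤⟨ hom-antitoneˡ _ (proj₂ to∘from x) ⟩
    hom 𝔹 x (map to (map from y))                      ≤⟨ hom-monotoneʳ x (proj₁ to∘from y) ⟩
    hom 𝔹 x y                                          ∎)
    where
    open Equivalent e
    open QCategoryProperties 𝔹
    open ≤-Reasoning

module Adjunction {Q : Quantaloid ℓ} {ℂ 𝔻 : QCategory Q}
  {S : QFunctor ℂ 𝔻} {T : QFunctor 𝔻 ℂ} (S⊣T : S ⊣ T) where
  open Quantaloid Q
  open QCategory
  open _⊣_ S⊣T
  private
    module ℂₚ = QCategoryProperties ℂ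
    module 𝔻ₚ = QCategoryProperties 𝔻

  transpose : ∀ {p q} (c : obj ℂ p) (d : obj 𝔻 q) →
    hom 𝔻 (map S c) d ≈ hom ℂ c (map T d)
  transpose c d = antisym
    (trans (map-hom T (map S c) d) (ℂₚ.hom-antitoneˡ (map T d) (unit c)))
    (trans (map-hom S c (map T d)) (𝔻ₚ.hom-monotoneʳ (map S c) (counit d)))

  STS≅S : ∀ {q} (c : obj ℂ q) → _≅_ 𝔻 (map S (map T (map S c))) (map S c)
  STS≅S c = counit (map S c) , map-⊑ S (unit c)

  TST≅T : ∀ {q} (d : obj 𝔻 q) → _≅_ ℂ (map T (map S (map T d))) (map T d)
  TST≅T d = map-⊑ T (counit d) , unit (map T d)

  -- TSc is the reflection of c into the fixed objects, among which is Td.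
  hom-TS : ∀ {p q} (c : obj ℂ p) (d : obj 𝔻 q) →
    hom ℂ (map T (map S c)) (map T d) ≈ hom ℂ c (map T d)
  hom-TS c d = Eq.trans (Eq.sym (transpose _ d))
    (Eq.trans (𝔻ₚ.hom-congˡ d (STS≅S c)) (transpose c d))

  -- Td as an object of Fix(TS).
  fixed : obj 𝔻 ⟶ obj (Fix (T ∘F S))
  fixed d = map T d , TST≅T d

  -- TS with its codomain restricted to Fix(TS).
  reflection : QFunctor ℂ (Fix (T ∘F S))
  reflection = record { map = λ c → fixed (map S c) ; map-hom = map-hom (T ∘F S) }

  inclusion : QFunctor (Fix (T ∘F S)) ℂ
  inclusion = record { map = proj₁ ; map-hom = λ _ _ → refl }

-- The representation theorem

module Representation {Q : Quantaloid ℓ} {ℂ 𝔻 : QCategory Q}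
  {S : QFunctor ℂ 𝔻} {T : QFunctor 𝔻 ℂ} (S⊣T : S ⊣ T) (𝕏 : QCategory Q) where
  open Quantaloid Q
  open QCategory
  open Adjunction S⊣T
  private
    module ℂₚ = QCategoryProperties ℂ
    module 𝔻ₚ = QCategoryProperties 𝔻
    module 𝕏ₚ = QCategoryProperties 𝕏

  -- Maps F, K, G, H as in the theorem, for fixed typed sets A and B.
  DenseData : (A B : TypedSet Q) → Set _
  DenseData A B =
    Σ[ F ∈ (A ⟶ obj 𝕏) ] Σ[ K ∈ (A ⟶ obj ℂ) ]
    Σ[ G ∈ (B ⟶ obj 𝕏) ] Σ[ H ∈ (B ⟶ obj 𝔻) ]
      ⋁-Dense A 𝕏 F × ⋁-Dense A ℂ K × ⋀-Dense B 𝕏 G × ⋀-Dense B 𝔻 H ×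
      (∀ {p q} (a : A p) (b : B q) →
         hom 𝔻 (map S (K a)) (H b) ≈ hom 𝕏 (F a) (G b))

  equivalence⇒denseData : Equivalent 𝕏 (Fix (T ∘F S)) → DenseData (obj ℂ) (obj 𝔻)
  equivalence⇒denseData e = F , id , G , id ,
    𝕏ₚ.essSurjective⇒⋁-dense (obj ℂ) F (λ y → proj₁ (map to y) , F∘to≅id y) ,
    ℂₚ.essSurjective⇒⋁-dense (obj ℂ) id (λ c → c , ℂₚ.≅-refl c) ,
    𝕏ₚ.essSurjective⇒⋀-dense (obj 𝔻) G
      (λ y → map S (proj₁ (map to y)) , F∘to≅id y) ,
    𝔻ₚ.essSurjective⇒⋀-dense (obj 𝔻) id (λ d → d , 𝔻ₚ.≅-refl d) ,
    λ c d → Eq.trans (transpose c d) (Eq.trans (Eq.sym (hom-TS c d))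
      (equivalence-fullyFaithful e (map reflection c) (fixed d)))
    where
    open Equivalent e
    F : obj ℂ ⟶ obj 𝕏
    F c = map from (map reflection c)
    G : obj 𝔻 ⟶ obj 𝕏
    G d = map from (fixed d)
    -- F c is G (S c), so this yields the essential surjectivity of both.
    F∘to≅id : ∀ {q} (y : obj 𝕏 q) → _≅_ 𝕏 (F (proj₁ (map to y))) y
    F∘to≅id y = 𝕏ₚ.≅-trans
      (map-≅ from {x = map reflection (proj₁ (map to y))} {y = map to y} (proj₂ (map to y)))
      (proj₁ from∘to y , proj₂ from∘to y)

  denseData⇒equivalence : Complete ℂ → Complete 𝕏 →
    {A B : TypedSet Q} → DenseData A B → Equivalent 𝕏 (Fix (T ∘F S))
  denseData⇒equivalence completeℂ complete𝕏 {A} {B}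
    (F , K , G , H , F-dense , K-dense , G-dense , H-dense , same) = record
    { to      = reflection ∘F φ
    ; from    = χ ∘F inclusion
    ; from∘to = (λ x → proj₁ (χTSφ≅id x)) , (λ x → proj₂ (χTSφ≅id x))
    ; to∘from = (λ c → proj₁ (TSφχ≅id c)) , (λ c → proj₂ (TSφχ≅id c))
    }
    where
    module φ = KanExtension {𝔸 = 𝕏} {𝔹 = ℂ} completeℂ F K
    module χ = KanExtension {𝔸 = ℂ} {𝔹 = 𝕏} complete𝕏 K F

    φ : QFunctor 𝕏 ℂ
    φ = φ.Lan
    χ : QFunctor ℂ 𝕏
    χ = χ.Lan

    same′ : ∀ {p q} (a : A p) (b : B q) → hom ℂ (K a) (map T (H b)) ≈ hom 𝕏 (F a) (G b)
    same′ a b = Eq.trans (Eq.sym (transpose (K a) (H b))) (same a b)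

    φ-hom : ∀ {q r} (x : obj 𝕏 q) (b : B r) →
      hom ℂ (map φ x) (map T (H b)) ≈ hom 𝕏 x (G b)
    φ-hom x b = φ.Lan-hom complete𝕏 F-dense _ _ (λ a → Eq.sym (same′ a b)) x

    χ-hom : ∀ {q r} (c : obj ℂ q) (b : B r) →
      hom 𝕏 (map χ c) (G b) ≈ hom ℂ c (map T (H b))
    χ-hom c b = χ.Lan-hom completeℂ K-dense _ _ (λ a → same′ a b) c

    χTSφ≅id : ∀ {q} (x : obj 𝕏 q) → _≅_ 𝕏 (map χ (map T (map S (map φ x)))) x
    χTSφ≅id x = 𝕏ₚ.⋀-dense-separates B G G-dense _ _ λ b →
      Eq.trans (χ-hom _ b) (Eq.trans (hom-TS (map φ x) (H b)) (φ-hom x b))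

    Sφχ≅S : ∀ {q} (c : obj ℂ q) → _≅_ 𝔻 (map S (map φ (map χ c))) (map S c)
    Sφχ≅S c = 𝔻ₚ.⋀-dense-separates B H H-dense _ _ λ b →
      Eq.trans (transpose _ (H b)) (Eq.trans (φ-hom (map χ c) b)
        (Eq.trans (χ-hom c b) (Eq.sym (transpose c (H b)))))

    TSφχ≅id : ∀ {q} ((c , _) : obj (Fix (T ∘F S)) q) →
      _≅_ ℂ (map T (map S (map φ (map χ c)))) c
    TSφχ≅id (c , TSc≅c) = ℂₚ.≅-trans (map-≅ T (Sφχ≅S c)) TSc≅c

theorem7p3 : ∀ {ℓ : Level} (Q : Quantaloid ℓ) (let open Quantaloid Q) (let open QCategory)
    (ℂ 𝔻 : QCategory Q) → Complete ℂ → Complete 𝔻 →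
    (S : QFunctor ℂ 𝔻) (T : QFunctor 𝔻 ℂ) → S ⊣ T →
    (𝕏 : QCategory Q) → Complete 𝕏 →
    Equivalent 𝕏 (Fix (T ∘F S))
    ⇔
    (Σ[ A ∈ TypedSet Q ] Σ[ B ∈ TypedSet Q ]
    Σ[ F ∈ (A ⟶ obj 𝕏) ] Σ[ K ∈ (A ⟶ obj ℂ) ]
    Σ[ G ∈ (B ⟶ obj 𝕏) ] Σ[ H ∈ (B ⟶ obj 𝔻) ]
    ⋁-Dense A 𝕏 F × ⋁-Dense A ℂ K × ⋀-Dense B 𝕏 G × ⋀-Dense B 𝔻 H ×
    (∀ {p q} (a : A p) (b : B q) →
    hom 𝔻 (map S (K a)) (H b) ≈ hom 𝕏 (F a) (G b)))
theorem7p3 Q ℂ 𝔻 completeℂ _ S T S⊣T 𝕏 complete𝕏 = mk⇔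
  (λ e → QCategory.obj ℂ , QCategory.obj 𝔻 , equivalence⇒denseData e)
  (λ (_ , _ , dense) → denseData⇒equivalence completeℂ complete𝕏 dense)
  where open Representation S⊣T 𝕏
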